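{- Let $L$ be either of the sequent calculi $\mathrm{sMC}^*$, $\mathrm{sCN}^*$. Then the rule (cut) is admissible in cut-free $L$. That is, for all finite sets $\Gamma,\Sigma$ of formulas and all formulas $\alpha,\gamma$: if $\Gamma\Rightarrow\alpha$ and $\alpha,\Sigma\Rightarrow\gamma$ are both provable in $L-(\mathrm{cut})$, then $\Gamma,\Sigma\Rightarrow\gamma$ is provable in $L-(\mathrm{cut})$.
   Context: Formulas are built from countably many propositional variables $p,q,\dots$ using the binary connectives $\land,\lor,\to$ and the unary connective $\sim$. A sequent is an expression $\Gamma\Rightarrow\gamma$ with $\Gamma$ a finite (possibly empty) set of formulas and $\gamma$ a single formula; $\alpha,\Gamma$ means $\{\alpha\}\cup\Gamma$ and $\Gamma,\Delta$ means $\Gamma\cup\Delta$. The calculus $\mathrm{sC}$ has the following initial sequents and rules ($p$ any propositional variable; $\alpha,\beta,\gamma$ any formulas; $\Gamma,\Delta,\Sigma$ any finite sets of formulas). Initial sequents: (init1) $p,\Gamma\Rightarrow p$; (init2) $\sim p,\Gamma\Rightarrow\sim p$. (cut): from $\Gamma\Rightarrow\alpha$ and $\alpha,\Sigma\Rightarrow\gamma$ infer $\Gamma,\Sigma\Rightarrow\gamma$. ($\to$left): from $\Gamma\Rightarrow\alpha$ and $\beta,\Delta\Rightarrow\gamma$ infer $\alpha\to\beta,\Gamma,\Delta\Rightarrow\gamma$. ($\to$right): from $\alpha,\Gamma\Rightarrow\beta$ infer $\Gamma\Rightarrow\alpha\to\beta$. ($\land$left): from $\alpha,\beta,\Gamma\Rightarrow\gamma$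 infer $\alpha\land\beta,\Gamma\Rightarrow\gamma$. ($\land$right): from $\Gamma\Rightarrow\alpha$ and $\Gamma\Rightarrow\beta$ infer $\Gamma\Rightarrow\alpha\land\beta$. ($\lor$left): from $\alpha,\Gamma\Rightarrow\gamma$ and $\beta,\Gamma\Rightarrow\gamma$ infer $\alpha\lor\beta,\Gamma\Rightarrow\gamma$. ($\lor$right1), ($\lor$right2): from $\Gamma\Rightarrow\alpha$ (respectively $\Gamma\Rightarrow\beta$) infer $\Gamma\Rightarrow\alpha\lor\beta$. ($\sim$left): from $\alpha,\Gamma\Rightarrow\gamma$ infer $\sim\sim\alpha,\Gamma\Rightarrow\gamma$. ($\sim$right): from $\Gamma\Rightarrow\alpha$ infer $\Gamma\Rightarrow\sim\sim\alpha$. ($\sim\to$left): from $\Gamma\Rightarrow\alpha$ and $\sim\beta,\Delta\Rightarrow\gamma$ infer $\sim(\alpha\to\beta),\Gamma,\Delta\Rightarrow\gamma$. ($\sim\to$right): from $\alpha,\Gamma\Rightarrow\sim\beta$ infer $\Gamma\Rightarrow\sim(\alpha\to\beta)$. ($\sim\land$left): from $\sim\alpha,\Gamma\Rightarrow\gamma$ and $\sim\beta,\Gamma\Rightarrow\gamma$ infer $\sim(\alpha\land\beta),\Gamma\Rightarrow\gamma$. ($\sim\land$right1), ($\sim\land$right2): from $\Gamma\Rightarrow\sim\alpha$ (respectively $\Gamma\Rightarrow\sim\beta$) infer $\Gamma\Rightarrow\sim(\alpha\land\beta)$. ($\sim\lor$left): from $\sim\alpha,\sim\beta,\Gamma\Rightarrow\gamma$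 infer $\sim(\alpha\lor\beta),\Gamma\Rightarrow\gamma$. ($\sim\lor$right): from $\Gamma\Rightarrow\sim\alpha$ and $\Gamma\Rightarrow\sim\beta$ infer $\Gamma\Rightarrow\sim(\alpha\lor\beta)$. Additional rules: (ex-middle): from $\sim\alpha,\Gamma\Rightarrow\gamma$ and $\alpha,\Gamma\Rightarrow\gamma$ infer $\Gamma\Rightarrow\gamma$. (g-ex-middle): from $\alpha\to\beta,\Gamma\Rightarrow\gamma$ and $\alpha,\Gamma\Rightarrow\gamma$ infer $\Gamma\Rightarrow\gamma$. $\mathrm{sMC}^*=\mathrm{sC}+$(g-ex-middle); $\mathrm{sCN}^*=\mathrm{sC}+$(ex-middle)$+$(g-ex-middle). "Cut-free $L$", written $L-(\mathrm{cut})$, is $L$ without the rule (cut). A rule is admissible in a calculus if, for every instance of it, provability of all premises in the calculus implies provability of the conclusion in the calculus. -}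

module Defs where

open import Data.Empty using (⊥)
open import Data.List.Base using (List; []; _∷_; _++_)
open import Data.List.Relation.Binary.BagAndSetEquality using (_∼[_]_; set)
open import Data.List.Relation.Unary.All using (All)
open import Data.Nat.Base using (ℕ)
open import Data.Unit.Base using (⊤)
open import Level using (0ℓ)
open import Relation.Unary using (Pred; _∈_; _∪_; _∖_; ｛_｝)

infix  9 ∼_
infixr 8 _∧_
infixr 7 _∨_
infixr 6 _⟶_
infix  4 _⇒_

data Formula : Set where
  var : ℕ → Formula
  _∧_ _∨_ _⟶_ : Formula → Formula → Formula
  ∼_ : Formula → Formula

-- The antecedent is a finite set, represented by a list; lists with the same
-- elements are identified by the set equality in `infer` below.
data Sequent : Set where
  _⇒_ : List Formula → Formula → Sequent

data Rule : Set where
  init1 init2 cut : Rule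
  →left →right ∧left ∧right ∨left ∨right1 ∨right2 : Rule
  ∼left ∼right : Rule
  ∼→left ∼→right ∼∧left ∼∧right1 ∼∧right2 ∼∨left ∼∨right : Rule
  ex-middle g-ex-middle : Rule

variable
  p : ℕ
  α β γ : Formula
  Γ Δ Σ : List Formula

-- `Instance r ps s`: the rule r infers the conclusion s from the premises ps.
data Instance : Rule → List Sequent → Sequent → Set where
  init1 : Instance init1 [] (var p ∷ Γ ⇒ var p)
  init2 : Instance init2 [] (∼ var p ∷ Γ ⇒ ∼ var p)

  cut : Instance cut ((Γ ⇒ α) ∷ (α ∷ Σ ⇒ γ) ∷ []) (Γ ++ Σ ⇒ γ)

  →left   : Instance →left ((Γ ⇒ α) ∷ (β ∷ Δ ⇒ γ) ∷ []) ((α ⟶ β) ∷ Γ ++ Δ ⇒ γ)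
  →right  : Instance →right ((α ∷ Γ ⇒ β) ∷ []) (Γ ⇒ α ⟶ β)
  ∧left   : Instance ∧left ((α ∷ β ∷ Γ ⇒ γ) ∷ []) ((α ∧ β) ∷ Γ ⇒ γ)
  ∧right  : Instance ∧right ((Γ ⇒ α) ∷ (Γ ⇒ β) ∷ []) (Γ ⇒ α ∧ β)
  ∨left   : Instance ∨left ((α ∷ Γ ⇒ γ) ∷ (β ∷ Γ ⇒ γ) ∷ []) ((α ∨ β) ∷ Γ ⇒ γ)
  ∨right1 : Instance ∨right1 ((Γ ⇒ α) ∷ []) (Γ ⇒ α ∨ β)
  ∨right2 : Instance ∨right2 ((Γ ⇒ β) ∷ []) (Γ ⇒ α ∨ β)

  ∼left  : Instance ∼left ((α ∷ Γ ⇒ γ) ∷ []) (∼ ∼ α ∷ Γ ⇒ γ)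
  ∼right : Instance ∼right ((Γ ⇒ α) ∷ []) (Γ ⇒ ∼ ∼ α)

  ∼→left   : Instance ∼→left ((Γ ⇒ α) ∷ (∼ β ∷ Δ ⇒ γ) ∷ []) (∼ (α ⟶ β) ∷ Γ ++ Δ ⇒ γ)
  ∼→right  : Instance ∼→right ((α ∷ Γ ⇒ ∼ β) ∷ []) (Γ ⇒ ∼ (α ⟶ β))
  ∼∧left   : Instance ∼∧left ((∼ α ∷ Γ ⇒ γ) ∷ (∼ β ∷ Γ ⇒ γ) ∷ []) (∼ (α ∧ β) ∷ Γ ⇒ γ)
  ∼∧right1 : Instance ∼∧right1 ((Γ ⇒ ∼ α) ∷ []) (Γ ⇒ ∼ (α ∧ β))
  ∼∧right2 : Instance ∼∧right2 ((Γ ⇒ ∼ β) ∷ []) (Γ ⇒ ∼ (α ∧ β))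
  ∼∨left   : Instance ∼∨left ((∼ α ∷ ∼ β ∷ Γ ⇒ γ) ∷ []) (∼ (α ∨ β) ∷ Γ ⇒ γ)
  ∼∨right  : Instance ∼∨right ((Γ ⇒ ∼ α) ∷ (Γ ⇒ ∼ β) ∷ []) (Γ ⇒ ∼ (α ∨ β))

  ex-middle   : Instance ex-middle ((∼ α ∷ Γ ⇒ γ) ∷ (α ∷ Γ ⇒ γ) ∷ []) (Γ ⇒ γ)
  g-ex-middle : Instance g-ex-middle (((α ⟶ β) ∷ Γ ⇒ γ) ∷ (α ∷ Γ ⇒ γ) ∷ []) (Γ ⇒ γ)

-- A calculus is given by the set of its rules.
Calculus : Set₁
Calculus = Pred Rule 0ℓ

sC : Calculus
sC ex-middle   = ⊥
sC g-ex-middle = ⊥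
sC _           = ⊤

sMC* : Calculus
sMC* = sC ∪ ｛ g-ex-middle ｝

sCN* : Calculus
sCN* = sC ∪ ｛ ex-middle ｝ ∪ ｛ g-ex-middle ｝

cut-free : Calculus → Calculus
cut-free L = L ∖ ｛ cut ｝

data Provable (L : Calculus) : Sequent → Set where
  infer : ∀ {r ps} → r ∈ L → Instance r ps (Γ ⇒ γ) → All (Provable L) ps →
          Γ ∼[ set ] Δ → Provable L (Δ ⇒ γ)

Admissible : Rule → Calculus → Set
Admissible r L = ∀ {ps s} → Instance r ps s → All (Provable L) ps → Provable L s

{-# OPTIONS --safe #-}

-- Cut elimination is carried out in an equivalent sequent calculus Γ ⊢ γ in
-- which left rules keep their principal formula, so that weakening, contraction
-- and exchange are all instances of renaming along Γ ⊆ Δ.  A cut is first pushed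
-- up the derivation of its right premise until the cut formula is principal
-- there, then up the derivation of its left premise until it is principal there
-- too, and is then replaced by cuts of smaller degree.  Both excluded-middle
-- rules have no principal formula and share their context and succedent with
-- their premises, so cuts permute above them on either side.
module Submission where

open import Data.List.Base using (List; []; _∷_; _++_)
open import Data.List.Membership.Propositional using (_∈_)
open import Data.List.Membership.Propositional.Properties using (∈-++⁻)
open import Data.List.Relation.Binary.BagAndSetEquality using (_∼[_]_; set)
open import Data.List.Relation.Binary.Subset.Propositional using (_⊆_)
open import Data.List.Relation.Binary.Subset.Propositional.Properties
  using (⊆-refl; ⊆-trans; ∷⁺ʳ; ∈-∷⁺ʳ; xs⊆x∷xs; xs⊆xs++ys; xs⊆ys++xs)
open import Data.List.Relation.Unary.All using (All; []; _∷_)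
open import Data.List.Relation.Unary.Any using (here; there)
open import Data.Product.Base using (_×_; _,_; proj₁; proj₂)
open import Data.Sum.Base using (_⊎_; inj₁; inj₂; [_,_])
open import Data.Unit.Base using (tt)
open import Function.Base using (id; _∘_)
open import Function.Bundles using (mk⇔; module Equivalence)
open import Relation.Binary.PropositionalEquality using (_≡_; refl)
import Relation.Unary as Unary
open import Defs

variable
  φ ψ : Formula

-- The shape of a formula fixes its left and right rules: ∼ (α ∨ β) behaves as a
-- conjunction, ∼ (α ∧ β) as a disjunction and ∼ (α ⟶ β) as the implication of
-- ∼ β by α.
data Shape : Set where
  literal  : Shape
  wrap     : Formula → Shape
  both one imp : Formula → Formula → Shape

shape : Formula → Shape
shape (var p)       = literal
shape (α ∧ β)       = both α β
shape (α ∨ β)       = one α β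
shape (α ⟶ β)       = imp α β
shape (∼ var p)     = literal
shape (∼ (α ∧ β))   = one (∼ α) (∼ β)
shape (∼ (α ∨ β))   = both (∼ α) (∼ β)
shape (∼ (α ⟶ β))   = imp α (∼ β)
shape (∼ ∼ α)       = wrap α

-- The components `∼ α` and `∼ β` of `∼ (α ∧ β)` are not subformulas of it. The degree of a cut is
-- therefore the tree of iterated decompositions, whose subtrees are structurally smaller degrees.
data Degree : Shape → Set where
  literal : Degree literal
  wrap    : Degree (shape α) → Degree (wrap α)
  both    : Degree (shape α) → Degree (shape β) → Degree (both α β)
  one     : Degree (shape α) → Degree (shape β) → Degree (one α β)
  imp     : Degree (shape α) → Degree (shape β) → Degree (imp α β)

-- Treating `α` and `∼ α` together supplies the hypotheses for negated components.
degrees : ∀ α → Degree (shape α) × Degree (shape (∼ α))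
degrees (var p) = literal , literal
degrees (α ∧ β) =
  let a , a′ = degrees α ; b , b′ = degrees β in both a b , one a′ b′
degrees (α ∨ β) =
  let a , a′ = degrees α ; b , b′ = degrees β in one a b , both a′ b′
degrees (α ⟶ β) =
  let a , _ = degrees α ; b , b′ = degrees β in imp a b , imp a b′
degrees (∼ α) = let a , a′ = degrees α in a′ , wrap a

module _ (L : Calculus) where

  -- The cut argument never inspects the pair, so a single rule `split` covers both excluded
  -- middles.
  data Split : Formula → Formula → Set where
    ex-middle   : ex-middle Unary.∈ L → Split (∼ α) α
    g-ex-middle : g-ex-middle Unary.∈ L → Split (α ⟶ β) α

  infix 4 _⊢_

  data _⊢_ (Γ : List Formula) (γ : Formula) : Set
  -- In `Right` and `Left` the shape is an index of its own, so matching on a rule does not require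
  -- inverting `shape`.
  data Right (Γ : List Formula) (γ : Formula) : Shape → Set
  data Left (Γ : List Formula) (γ : Formula) : Shape → Set

  data _⊢_ Γ γ where
    right : Right Γ γ (shape γ) → Γ ⊢ γ
    left  : φ ∈ Γ → Left Γ γ (shape φ) → Γ ⊢ γ
    split : Split φ ψ → φ ∷ Γ ⊢ γ → ψ ∷ Γ ⊢ γ → Γ ⊢ γ

  data Right Γ γ where
    init : γ ∈ Γ → Right Γ γ literal
    wrap : Γ ⊢ α → Right Γ γ (wrap α)
    both : Γ ⊢ α → Γ ⊢ β → Right Γ γ (both α β)
    one₁ : Γ ⊢ α → Right Γ γ (one α β)
    one₂ : Γ ⊢ β → Right Γ γ (one α β)
    imp  : α ∷ Γ ⊢ β → Right Γ γ (imp α β)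

  data Left Γ γ where
    wrap : α ∷ Γ ⊢ γ → Left Γ γ (wrap α)
    both : α ∷ β ∷ Γ ⊢ γ → Left Γ γ (both α β)
    one  : α ∷ Γ ⊢ γ → β ∷ Γ ⊢ γ → Left Γ γ (one α β)
    imp  : Γ ⊢ α → β ∷ Γ ⊢ γ → Left Γ γ (imp α β)

  rename : Γ ⊆ Δ → Γ ⊢ γ → Δ ⊢ γ
  renameRight : ∀ {s} → Γ ⊆ Δ → Right Γ γ s → Right Δ γ s
  renameLeft : ∀ {s} → Γ ⊆ Δ → Left Γ γ s → Left Δ γ s

  rename ρ (right r)     = right (renameRight ρ r)
  rename ρ (left i l)    = left (ρ i) (renameLeft ρ l)
  rename ρ (split s d e) = split s (rename (∷⁺ʳ _ ρ) d) (rename (∷⁺ʳ _ ρ) e)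

  renameRight ρ (init i)   = init (ρ i)
  renameRight ρ (wrap d)   = wrap (rename ρ d)
  renameRight ρ (both d e) = both (rename ρ d) (rename ρ e)
  renameRight ρ (one₁ d)   = one₁ (rename ρ d)
  renameRight ρ (one₂ d)   = one₂ (rename ρ d)
  renameRight ρ (imp d)    = imp (rename (∷⁺ʳ _ ρ) d)

  renameLeft ρ (wrap d)   = wrap (rename (∷⁺ʳ _ ρ) d)
  renameLeft ρ (both d)   = both (rename (∷⁺ʳ _ (∷⁺ʳ _ ρ)) d)
  renameLeft ρ (one d e)  = one (rename (∷⁺ʳ _ ρ) d) (rename (∷⁺ʳ _ ρ) e)
  renameLeft ρ (imp d e)  = imp (rename ρ d) (rename (∷⁺ʳ _ ρ) e)

  weaken : Γ ⊢ γ → φ ∷ Γ ⊢ γ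
  weaken = rename (xs⊆x∷xs _ _)

  under : Δ ⊆ φ ∷ Γ → ψ ∷ Δ ⊆ φ ∷ ψ ∷ Γ
  under ρ = ∈-∷⁺ʳ (there (here refl)) (⊆-trans ρ (∷⁺ʳ _ (xs⊆x∷xs _ _)))

  -- Allowing any `Δ ⊆ φ ∷ Γ` absorbs exchanges, so the right derivation is never renamed and
  -- recursion on it stays structural. At a fixed degree, `cut′` descends the right derivation and
  -- `principal` the left one; only `reduce` changes the degree.
  cut′ : Degree (shape φ) → Γ ⊢ φ → Δ ⊆ φ ∷ Γ → Δ ⊢ γ → Γ ⊢ γ
  -- The second alternative arises from an axiom on the cut formula: then `γ` is `φ` and the left
  -- premise already proves the goal.
  cutRight : ∀ {s} → Degree (shape φ) → Γ ⊢ φ → Δ ⊆ φ ∷ Γ →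
             Right Δ γ s → Right Γ γ s ⊎ Γ ⊢ γ
  cutLeft : ∀ {s} → Degree (shape φ) → Γ ⊢ φ → Δ ⊆ φ ∷ Γ →
            Left Δ γ s → Left Γ γ s
  -- Induction on the derivation of `φ`: the left inference is carried upward and renamed until `φ`
  -- is introduced on the right.
  principal : Degree (shape φ) → Γ ⊢ φ → Γ ⊆ Δ → Left Δ γ (shape φ) → Δ ⊢ γ
  principalLeft : ∀ {s} → Degree (shape φ) → Left Γ φ s → Γ ⊆ Δ →
                  Left Δ γ (shape φ) → Left Δ γ s
  -- Literals need no case, having no left rule.
  reduce : ∀ {s} → Degree s → Right Γ φ s → Left Γ γ s → Γ ⊢ γ

  cut′ k d ρ (right r) = [ right , id ] (cutRight k d ρ r)
  cut′ k d ρ (left i l) with ρ i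
  -- The premises of `l` may still contain the retained `φ`; `cutLeft` removes it from them first.
  ... | here refl = principal k d ⊆-refl (cutLeft k d ρ l)
  ... | there j   = left j (cutLeft k d ρ l)
  cut′ k d ρ (split s e f) =
    split s (cut′ k (weaken d) (under ρ) e) (cut′ k (weaken d) (under ρ) f)

  cutRight k d ρ (init i) with ρ i
  ... | here refl = inj₂ d
  ... | there j   = inj₁ (init j)
  cutRight k d ρ (wrap e)   = inj₁ (wrap (cut′ k d ρ e))
  cutRight k d ρ (both e f) = inj₁ (both (cut′ k d ρ e) (cut′ k d ρ f))
  cutRight k d ρ (one₁ e)   = inj₁ (one₁ (cut′ k d ρ e))
  cutRight k d ρ (one₂ e)   = inj₁ (one₂ (cut′ k d ρ e))
  cutRight k d ρ (imp e)    = inj₁ (imp (cut′ k (weaken d) (under ρ) e))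

  cutLeft k d ρ (wrap e)  = wrap (cut′ k (weaken d) (under ρ) e)
  cutLeft k d ρ (both e)  =
    both (cut′ k (weaken (weaken d)) (under (under ρ)) e)
  cutLeft k d ρ (one e f) =
    one (cut′ k (weaken d) (under ρ) e) (cut′ k (weaken d) (under ρ) f)
  cutLeft k d ρ (imp e f) = imp (cut′ k d ρ e) (cut′ k (weaken d) (under ρ) f)

  principal k (right r) ρ l = reduce k (renameRight ρ r) l
  principal k (left i m) ρ l = left (ρ i) (principalLeft k m ρ l)
  principal k (split s d e) ρ l =
    split s (principal k d (∷⁺ʳ _ ρ) (renameLeft (xs⊆x∷xs _ _) l))
            (principal k e (∷⁺ʳ _ ρ) (renameLeft (xs⊆x∷xs _ _) l))

  principalLeft k (wrap d) ρ l =
    wrap (principal k d (∷⁺ʳ _ ρ) (renameLeft (xs⊆x∷xs _ _) l))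
  principalLeft k (both d) ρ l =
    both (principal k d (∷⁺ʳ _ (∷⁺ʳ _ ρ)) (renameLeft (xs⊆ys++xs _ (_ ∷ _ ∷ [])) l))
  principalLeft k (one d e) ρ l =
    one (principal k d (∷⁺ʳ _ ρ) (renameLeft (xs⊆x∷xs _ _) l))
        (principal k e (∷⁺ʳ _ ρ) (renameLeft (xs⊆x∷xs _ _) l))
  principalLeft k (imp d e) ρ l =
    imp (rename ρ d) (principal k e (∷⁺ʳ _ ρ) (renameLeft (xs⊆x∷xs _ _) l))

  reduce (wrap k)   (wrap d)   (wrap e)  = cut′ k d ⊆-refl e
  reduce (both k m) (both d e) (both f)  =
    cut′ m e ⊆-refl (cut′ k (weaken d) ⊆-refl f)
  reduce (one k m)  (one₁ d)   (one e f) = cut′ k d ⊆-refl e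
  reduce (one k m)  (one₂ d)   (one e f) = cut′ m d ⊆-refl f
  -- The inner cut may yield a large derivation of `β`, but the outer cut has degree `m`, a subtree
  -- of `imp k m`.
  reduce (imp k m)  (imp d)    (imp e f) =
    cut′ m (cut′ k e ⊆-refl d) ⊆-refl f

  ⊢-cut : Γ ⊢ φ → φ ∷ Γ ⊢ γ → Γ ⊢ γ
  ⊢-cut d = cut′ (proj₁ (degrees _)) d ⊆-refl

  leftHead : Left Γ γ (shape φ) → φ ∷ Γ ⊢ γ
  leftHead l = left (here refl) (renameLeft (xs⊆x∷xs _ _) l)

  -- Merges the separate contexts of the two implication left rules into a shared one.
  impLeft : Γ ⊢ α → β ∷ Δ ⊢ γ → Left (Γ ++ Δ) γ (imp α β)
  impLeft {Γ = Γ} {Δ = Δ} d e =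
    imp (rename (xs⊆xs++ys Γ Δ) d) (rename (∷⁺ʳ _ (xs⊆ys++xs Δ Γ)) e)

  sound : Provable (cut-free L) (Γ ⇒ γ) → Γ ⊢ γ
  sound (infer m i ps eq) = rename (Equivalence.to eq) (instances m i ps)
    where
    instances : ∀ {r ps} → r Unary.∈ cut-free L → Instance r ps (Γ ⇒ γ) →
                All (Provable (cut-free L)) ps → Γ ⊢ γ
    instances m init1 [] = right (init (here refl))
    instances m init2 [] = right (init (here refl))
    instances m cut _ with () ← proj₂ m refl
    instances m →left (d ∷ e ∷ []) = leftHead (impLeft (sound d) (sound e))
    instances m →right (d ∷ []) = right (imp (sound d))
    instances m ∧left (d ∷ []) = leftHead (both (sound d))
    instances m ∧right (d ∷ e ∷ []) = right (both (sound d) (sound e))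
    instances m ∨left (d ∷ e ∷ []) = leftHead (one (sound d) (sound e))
    instances m ∨right1 (d ∷ []) = right (one₁ (sound d))
    instances m ∨right2 (d ∷ []) = right (one₂ (sound d))
    instances m ∼left (d ∷ []) = leftHead (wrap (sound d))
    instances m ∼right (d ∷ []) = right (wrap (sound d))
    instances m ∼→left (d ∷ e ∷ []) = leftHead (impLeft (sound d) (sound e))
    instances m ∼→right (d ∷ []) = right (imp (sound d))
    instances m ∼∧left (d ∷ e ∷ []) = leftHead (one (sound d) (sound e))
    instances m ∼∧right1 (d ∷ []) = right (one₁ (sound d))
    instances m ∼∧right2 (d ∷ []) = right (one₂ (sound d))
    instances m ∼∨left (d ∷ []) = leftHead (both (sound d))
    instances m ∼∨right (d ∷ e ∷ []) = right (both (sound d) (sound e))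
    instances m ex-middle (d ∷ e ∷ []) =
      split (ex-middle (proj₁ m)) (sound d) (sound e)
    instances m g-ex-middle (d ∷ e ∷ []) =
      split (g-ex-middle (proj₁ m)) (sound d) (sound e)

  same : Γ ∼[ set ] Γ
  same = mk⇔ id id

  -- Contracts the principal formula adjoined by a rule with the copy that `⊢` retains.
  absorb : φ ∈ Γ → φ ∷ Γ ∼[ set ] Γ
  absorb i = mk⇔ (∈-∷⁺ʳ i id) there

  absorb-++ : φ ∈ Γ → φ ∷ Γ ++ Γ ∼[ set ] Γ
  absorb-++ {Γ = Γ} i =
    mk⇔ (∈-∷⁺ʳ i ([ id , id ] ∘ ∈-++⁻ Γ)) (there ∘ xs⊆xs++ys Γ Γ)

  module _ (sC⊆L : sC Unary.⊆ L) where

    complete : Γ ⊢ γ → Provable (cut-free L) (Γ ⇒ γ)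
    -- Distinct rules share a shape; matching on the formula recovers which one applies.
    completeRight : ∀ γ → Right Γ γ (shape γ) → Provable (cut-free L) (Γ ⇒ γ)
    completeLeft : ∀ φ → φ ∈ Γ → Left Γ γ (shape φ) →
                   Provable (cut-free L) (Γ ⇒ γ)

    complete (right r)  = completeRight _ r
    complete (left i l) = completeLeft _ i l
    complete (split (ex-middle m) d e) =
      infer (m , λ ()) ex-middle (complete d ∷ complete e ∷ []) same
    complete (split (g-ex-middle m) d e) =
      infer (m , λ ()) g-ex-middle (complete d ∷ complete e ∷ []) same

    completeRight (var p) (init i) =
      infer (sC⊆L {init1} tt , λ ()) init1 [] (absorb i)
    completeRight (α ∧ β) (both d e) =
      infer (sC⊆L {∧right} tt , λ ()) ∧right (complete d ∷ complete e ∷ []) same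
    completeRight (α ∨ β) (one₁ d) =
      infer (sC⊆L {∨right1} tt , λ ()) ∨right1 (complete d ∷ []) same
    completeRight (α ∨ β) (one₂ d) =
      infer (sC⊆L {∨right2} tt , λ ()) ∨right2 (complete d ∷ []) same
    completeRight (α ⟶ β) (imp d) =
      infer (sC⊆L {→right} tt , λ ()) →right (complete d ∷ []) same
    completeRight (∼ var p) (init i) =
      infer (sC⊆L {init2} tt , λ ()) init2 [] (absorb i)
    completeRight (∼ (α ∧ β)) (one₁ d) =
      infer (sC⊆L {∼∧right1} tt , λ ()) ∼∧right1 (complete d ∷ []) same
    completeRight (∼ (α ∧ β)) (one₂ d) =
      infer (sC⊆L {∼∧right2} tt , λ ()) ∼∧right2 (complete d ∷ []) same
    completeRight (∼ (α ∨ β)) (both d e) =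
      infer (sC⊆L {∼∨right} tt , λ ()) ∼∨right (complete d ∷ complete e ∷ []) same
    completeRight (∼ (α ⟶ β)) (imp d) =
      infer (sC⊆L {∼→right} tt , λ ()) ∼→right (complete d ∷ []) same
    completeRight (∼ ∼ α) (wrap d) =
      infer (sC⊆L {∼right} tt , λ ()) ∼right (complete d ∷ []) same

    completeLeft (α ∧ β) i (both d) =
      infer (sC⊆L {∧left} tt , λ ()) ∧left (complete d ∷ []) (absorb i)
    completeLeft (α ∨ β) i (one d e) =
      infer (sC⊆L {∨left} tt , λ ()) ∨left (complete d ∷ complete e ∷ []) (absorb i)
    completeLeft (α ⟶ β) i (imp d e) =
      infer (sC⊆L {→left} tt , λ ()) →left (complete d ∷ complete e ∷ []) (absorb-++ i)
    completeLeft (∼ (α ∧ β)) i (one d e) =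
      infer (sC⊆L {∼∧left} tt , λ ()) ∼∧left (complete d ∷ complete e ∷ []) (absorb i)
    completeLeft (∼ (α ∨ β)) i (both d) =
      infer (sC⊆L {∼∨left} tt , λ ()) ∼∨left (complete d ∷ []) (absorb i)
    completeLeft (∼ (α ⟶ β)) i (imp d e) =
      infer (sC⊆L {∼→left} tt , λ ()) ∼→left (complete d ∷ complete e ∷ []) (absorb-++ i)
    completeLeft (∼ ∼ α) i (wrap d) =
      infer (sC⊆L {∼left} tt , λ ()) ∼left (complete d ∷ []) (absorb i)

    cut-admissible : Admissible cut (cut-free L)
    -- Both premises are weakened to the common context `Γ ++ Σ`, since `⊢-cut` shares its context.
    cut-admissible (cut {Γ = Γ} {Σ = Σ}) (d ∷ e ∷ []) =
      complete (⊢-cut (rename (xs⊆xs++ys Γ Σ) (sound d))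
                      (rename (∷⁺ʳ _ (xs⊆ys++xs Σ Γ)) (sound e)))

theorem2p13 : (L : Calculus) → L ≡ sMC* ⊎ L ≡ sCN* → Admissible cut (cut-free L)
theorem2p13 L (inj₁ refl) = cut-admissible L inj₁
theorem2p13 L (inj₂ refl) = cut-admissible L inj₁
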